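{- Let $M$ be an ultrahomogeneous structure (in a countable relational language). Let $\bar a\in\mathrm{Age}(M)$, let $B\in\mathrm{Age}(M)$ and let $k\geq 1$ be an integer. Let $\Phi$ be a finite set of formulae with free variables among $\bar x,\bar y$, where $|\bar y|=|\bar a|$. Then $M\to_{\mathrm{ext}(\Phi)}(B)^{\bar a}_k$ if and only if there exists $C\in\mathrm{Age}(M)$ with $C\to_{\mathrm{ext}(\Phi)}(B)^{\bar a}_k$.
   Context: All first-order languages are countable and relational. A structure $M$ is ultrahomogeneous if every isomorphism between finite substructures of $M$ extends to an automorphism of $M$. $\mathrm{Age}(M)$ is the class of finite structures embeddable in $M$. Writing $\bar a\in\mathrm{Age}(M)$ means a structure $A\in\mathrm{Age}(M)$ together with an enumeration $\bar a$ (without repetition) of its elements. For a structure $B$, $\binom{B}{\bar a}=\{f(\bar a): f:A\to B \text{ an embedding}\}$; for structures $B,C$, $\binom{C}{B}$ is the set of substructures of $C$ isomorphic to $B$. A $k$-colouring $\chi:\binom{M}{\bar a}\to k=\{0,\dots,k-1\}$ is externally definable by formulae $\phi_0(\bar x,\bar y),\dots,\phi_{k-1}(\bar x,\bar y)$ (without parameters; $\bar x$ a finite tuple of variables) if there are an elementary extension $N\succeq M$ and a tuple $\bar e$ in $N$ such that for all $\bar a'\in\binom{M}{\bar a}$ and $i<k$: $\chi(\bar a')=i\iff N\models\phi_i(\bar e,\bar a')$. Let $\Gamma=\mathrm{ext}(\Phi,\binom{M}{\bar a},k)$ be the set of all $k$-colourings of $\binom{M}{\bar a}$ externally definable (in some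 elementary extension of $M$) by $k$ formulae from $\Phi$. $M\to_{\mathrm{ext}(\Phi)}(B)^{\bar a}_k$ means: for every $\chi\in\Gamma$ there is $B'\in\binom{M}{B}$ such that $\chi$ is constant on $\binom{B'}{\bar a}$. For $C\in\mathrm{Age}(M)$, $C\to_{\mathrm{ext}(\Phi)}(B)^{\bar a}_k$ means: for every $C'\in\binom{M}{C}$ and every $\chi\in\Gamma$ there is $B'\in\binom{C'}{B}$ such that $\chi$ is constant on $\binom{B'}{\bar a}$. -}

module Defs where

open import Data.Fin.Base using (Fin)
open import Data.List.Base using (List)
open import Data.List.Membership.Propositional using () renaming (_∈_ to _∈ᴸ_)
open import Data.Nat.Base using (ℕ; suc; _+_)
open import Data.Product.Base using (Σ; ∃; _×_; _,_; proj₁; proj₂)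
open import Data.Refinement as Refinement using (Refinement; value)
open import Data.Vec.Base using (Vec; _∷_; _++_; lookup; map)
open import Data.Vec.Membership.Propositional using () renaming (_∈_ to _∈ⱽ_)
open import Data.Vec.Properties using (map-∘)
open import Data.Vec.Relation.Unary.Unique.Propositional using (Unique)
open import Function.Base using (_∘_)
open import Function.Bundles using (_⇔_; _↣_; _⤖_; mk⇔; Equivalence)
open import Function.Definitions using (Injective; Surjective)
open import Level using (Level; _⊔_) renaming (suc to lsuc)
open import Relation.Binary.PropositionalEquality
  using (_≡_; refl; sym; trans; cong; subst)
open import Relation.Nullary.Negation.Core using (¬_)
open import Relation.Unary using (Pred)

private
  variable
    ℓ : Level
    k m n : ℕ

record Language : Set₁ where
  field
    Rel       : Set
    arity     : Rel → ℕ
    countable : Rel ↣ ℕ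

record Structure (L : Language) (ℓ : Level) : Set (lsuc ℓ) where
  open Language L
  field
    Carrier : Set ℓ
    interp  : (R : Rel) → Vec Carrier (arity R) → Set ℓ

open Structure public using (Carrier)

private
  variable
    L : Language

------------------------------------------------------------------------
-- Embeddings, isomorphisms, substructures

-- Relations are both preserved and reflected.
record Embedding {L : Language} (A B : Structure L ℓ) : Set ℓ where
  field
    to        : Carrier A → Carrier B
    injective : Injective _≡_ _≡_ to
    relations : ∀ R (v : Vec (Carrier A) (Language.arity L R)) →
                Structure.interp A R v ⇔ Structure.interp B R (map to v)

record _≅_ {L : Language} (A B : Structure L ℓ) : Set ℓ where
  field
    embedding  : Embedding A B
    surjective : Surjective _≡_ _≡_ (Embedding.to embedding)

  open Embedding embedding public

infix 4 _≅_

_∘ᴱ_ : {A B C : Structure L ℓ} → Embedding B C → Embedding A B → Embedding A C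
_∘ᴱ_ {L = L} {A = A} {C = C} g f = record
  { to        = g.to ∘ f.to
  ; injective = f.injective ∘ g.injective
  ; relations = λ R v → mk⇔
      (subst (Structure.interp C R) (sym (map-∘ g.to f.to v))
        ∘ Equivalence.to (g.relations R _) ∘ Equivalence.to (f.relations R v))
      (Equivalence.from (f.relations R v) ∘ Equivalence.from (g.relations R _)
        ∘ subst (Structure.interp C R) (map-∘ g.to f.to v))
  }
  where
  module f = Embedding f
  module g = Embedding g

-- The substructure of M on a subset P.  Its elements carry a
-- proof-irrelevant witness of membership, so they are equal as soon as
-- they are equal in M.
_↾_ : (M : Structure L ℓ) → Pred (Carrier M) ℓ → Structure L ℓ
M ↾ P = record
  { Carrier = Refinement (Carrier M) P
  ; interp  = λ R v → Structure.interp M R (map value v)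
  }

infixl 6 _↾_

inclusion : (M : Structure L ℓ) (P : Pred (Carrier M) ℓ) → Embedding (M ↾ P) M
inclusion M P = record
  { to        = value
  ; injective = Refinement.value-injective
  ; relations = λ R v → mk⇔ (λ r → r) (λ r → r)
  }

-- The binomial of C over B: substructures of C isomorphic to B.
CopyIn : (C B : Structure L ℓ) → Set (lsuc ℓ)
CopyIn C B = Σ (Pred (Carrier C) _) λ P → B ≅ (C ↾ P)

Finite : Structure L ℓ → Set ℓ
Finite A = ∃ λ n → Fin n ⤖ Carrier A

InAge : Structure L ℓ → Structure L ℓ → Set ℓ
InAge M A = Finite A × Embedding A M

Ultrahomogeneous : Structure L ℓ → Set (lsuc ℓ)
Ultrahomogeneous {ℓ = ℓ} M =
  (P Q : Pred (Carrier M) ℓ) → Finite (M ↾ P) → Finite (M ↾ Q) →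
  (f : (M ↾ P) ≅ (M ↾ Q)) →
  Σ (M ≅ M) λ σ → ∀ x → _≅_.to σ (value x) ≡ value (_≅_.to f x)

------------------------------------------------------------------------
-- Enumerated structures and copies of tuples

record Enumerated (L : Language) (ℓ : Level) : Set (lsuc ℓ) where
  field
    structure : Structure L ℓ
    size      : ℕ
    tuple     : Vec (Carrier structure) size
    unique    : Unique tuple
    covering  : ∀ x → x ∈ⱽ tuple

open Enumerated public using (size)

-- The binomial of B over ā: the set of tuples f(ā), f : A → B an embedding.
-- Elements are tuples, not embeddings: the witness f is proof-irrelevant.
Tuples : Structure L ℓ → Enumerated L ℓ → Set ℓ
Tuples B ā = Refinement (Vec (Carrier B) (size ā)) λ v →
  Σ (Embedding (Enumerated.structure ā) B) λ f →
    map (Embedding.to f) (Enumerated.tuple ā) ≡ v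

mapTuples : {B C : Structure L ℓ} (ā : Enumerated L ℓ) →
            Embedding B C → Tuples B ā → Tuples C ā
mapTuples ā g = Refinement.map (map (Embedding.to g)) λ (f , eq) →
  (g ∘ᴱ f) , trans (map-∘ _ _ (Enumerated.tuple ā)) (cong (map (Embedding.to g)) eq)

Colouring : Structure L ℓ → Enumerated L ℓ → ℕ → Set ℓ
Colouring M ā k = Tuples M ā → Fin k

Constant : {X : Set ℓ} → (X → Fin k) → Set ℓ
Constant χ = ∀ u v → χ u ≡ χ v

------------------------------------------------------------------------
-- First-order logic

-- Formulae with free variables among n de Bruijn variables; the variable
-- bound by ex becomes the new first one.  The remaining connectives and
-- the universal quantifier are the usual classical abbreviations.
data Formula (L : Language) (n : ℕ) : Set where
  eq  : Fin n → Fin n → Formula L n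
  rel : (R : Language.Rel L) → Vec (Fin n) (Language.arity L R) → Formula L n
  neg : Formula L n → Formula L n
  and : Formula L n → Formula L n → Formula L n
  ex  : Formula L (suc n) → Formula L n

infix 4 _⊨_[_]

_⊨_[_] : (M : Structure L ℓ) → Formula L n → Vec (Carrier M) n → Set ℓ
M ⊨ eq i j    [ v ] = lookup v i ≡ lookup v j
M ⊨ rel R is  [ v ] = Structure.interp M R (map (lookup v) is)
M ⊨ neg φ     [ v ] = ¬ (M ⊨ φ [ v ])
M ⊨ and φ ψ   [ v ] = (M ⊨ φ [ v ]) × (M ⊨ ψ [ v ])
M ⊨ ex φ      [ v ] = ∃ λ x → M ⊨ φ [ x ∷ v ]

-- N ⪰ M, with M identified with its image under an elementary embedding.
record ElementaryExtension (M : Structure L ℓ) : Set (lsuc ℓ) where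
  field
    extension  : Structure L ℓ
    embed      : Carrier M → Carrier extension
    elementary : ∀ {n} (φ : Formula _ n) (v : Vec (Carrier M) n) →
                 (M ⊨ φ [ v ]) ⇔ (extension ⊨ φ [ map embed v ])

------------------------------------------------------------------------
-- Externally definable colourings

-- The first m variables of the formulae are x̄, the remaining ones are ȳ.
ExternallyDefinableBy : (M : Structure L ℓ) (ā : Enumerated L ℓ) →
                        (Fin k → Formula L (m + size ā)) →
                        Colouring M ā k → Set (lsuc ℓ)
ExternallyDefinableBy {m = m} M ā φ χ =
  Σ (ElementaryExtension M) λ N → let open ElementaryExtension N in
  Σ (Vec (Carrier extension) m) λ e →
    ∀ a′ i → χ a′ ≡ i ⇔ (extension ⊨ φ i [ e ++ map embed (value a′) ])

-- χ ∈ ext(Φ, Tuples M ā, k)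
ExternallyDefinable : (M : Structure L ℓ) (ā : Enumerated L ℓ) →
                      List (Formula L (m + size ā)) →
                      Colouring M ā k → Set (lsuc ℓ)
ExternallyDefinable {m = m} {k = k} M ā Φ χ =
  Σ (Fin k → Formula _ (m + size ā)) λ φ →
    (∀ i → φ i ∈ᴸ Φ) × ExternallyDefinableBy M ā φ χ

------------------------------------------------------------------------
-- Partition arrows

-- M →ext(Φ) (B)^ā_k
WholeArrow : (M : Structure L ℓ) (ā : Enumerated L ℓ) →
             List (Formula L (m + size ā)) → Structure L ℓ → ℕ → Set (lsuc ℓ)
WholeArrow M ā Φ B k =
  (χ : Colouring M ā k) → ExternallyDefinable M ā Φ χ →
  Σ (CopyIn M B) λ B′ →
    Constant (χ ∘ mapTuples ā (inclusion M (proj₁ B′)))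

-- C →ext(Φ) (B)^ā_k, where colourings are of tuples of the ambient M
AgeArrow : (M : Structure L ℓ) (ā : Enumerated L ℓ) →
           List (Formula L (m + size ā)) →
           Structure L ℓ → Structure L ℓ → ℕ → Set (lsuc ℓ)
AgeArrow M ā Φ C B k =
  (C′ : CopyIn M C) (χ : Colouring M ā k) → ExternallyDefinable M ā Φ χ →
  Σ (CopyIn (M ↾ proj₁ C′) B) λ B′ →
    Constant (χ ∘ mapTuples ā (inclusion M (proj₁ C′))
                ∘ mapTuples ā (inclusion (M ↾ proj₁ C′) (proj₁ B′)))

{-# OPTIONS --safe #-}

-- If no finite C works, then every finite subset F of M carries, by ultrahomogeneity,
-- an externally definable colouring χ_F of M that is constant on no copy of B inside F.
-- Along an ultrafilter on the finite subsets of M containing every cone {F ∣ F ⊇ G},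
-- the χ_F converge to a colouring χ.  By Łoś, χ is externally definable in the
-- ultraproduct of the elementary extensions defining the χ_F; the defining formulae
-- also converge because Φ is finite.  A copy of B on which χ is constant is contained
-- in some F for which χ_F agrees with χ on its finitely many tuples: a contradiction.
--
-- Excluded middle for arbitrary types yields a global choice operator, so the
-- ultrafilter comes from the Teichmüller–Tukey lemma.
module Submission where

open import Defs
open import Axiom.ExcludedMiddle using (ExcludedMiddle)
open import Axiom.Extensionality.Propositional using (Extensionality)
open import Data.Bool.Base using (Bool; T; _∨_)
open import Data.Bool.Properties using (T-≡; T-∨; ⇔→≡)
open import Data.Empty using (⊥-elim)
open import Data.Fin.Base using (Fin; zero; suc)
open import Data.List.Base as List using (List; []; _∷_)
open import Data.List.Membership.Propositional using (_∈_)
open import Data.List.Membership.Propositional.Properties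
  using (∈-lookup; ∈-tabulate⁺; ∈-deduplicate⁺; ∈-deduplicate⁻)
open import Data.List.Relation.Binary.Subset.Propositional using (_⊆_)
open import Data.List.Relation.Binary.Subset.Propositional.Properties
  using (All-resp-⊇; ∷⁺ʳ; ∈-∷⁺ʳ; xs⊆x∷xs; xs⊆xs++ys; xs⊆ys++xs; ⊆-trans)
open import Data.List.Relation.Unary.All as All using (All; []; _∷_)
import Data.List.Relation.Unary.All.Properties as All
open import Data.List.Relation.Unary.Any using (here; there; index)
open import Data.List.Relation.Unary.Any.Properties using (lookup-index)
import Data.List.Relation.Unary.Unique.DecPropositional.Properties as Unique
open import Data.List.Relation.Unary.Unique.Propositional using (Unique; _∷_)
open import Data.Nat.Base using (ℕ; _+_; _≥_; zero; suc)
open import Data.Product.Base using (∃; Σ; _×_; _,_; proj₁; proj₂)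
open import Data.Sum.Base as Sum using (_⊎_; inj₁; inj₂)
open import Data.Irrelevant using ([_])
open import Data.Refinement using (Refinement; _,_; value; value-injective)
open import Data.Vec.Properties using (lookup-map; map-∘; map-cong; map-id; map-++; tabulate-∘; tabulate∘lookup)
open import Data.Vec.Base using (Vec; []; _∷_; _++_; lookup; map; tabulate)
open import Function.Base using (_∘_; id)
open import Function.Bundles using (_⇔_; mk⇔; Equivalence; mk⤖; Bijection)
open import Function.Construct.Composition using (_⤖-∘_) renaming (_⇔-∘_ to infixr 8 _⇔-∘_)
open import Function.Construct.Symmetry using (⇔-sym)
open import Level using (Level)
open import Relation.Binary.PropositionalEquality
  using (_≡_; refl; sym; trans; cong; cong₂; subst)
open import Relation.Nullary.Decidable using (Dec; yes; no; isYes; recompute; toWitness; fromWitness; decidable-stable)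
open import Relation.Nullary.Negation using (¬_; contradiction)
open import Relation.Unary using (Pred; ∁; _∩_)

private
  variable
    ℓ : Level
    L : Language
    A B C M : Structure L ℓ

-- Embeddings, copies and their action on tuples.

module _ (ā : Enumerated L ℓ) where

  mapTuples-cong : (f g : Embedding A B) → (∀ x → Embedding.to f x ≡ Embedding.to g x) →
                   ∀ u → mapTuples ā f u ≡ mapTuples ā g u
  mapTuples-cong f g p u = value-injective (map-cong p (value u))

  mapTuples-∘ : (g : Embedding B C) (f : Embedding A B) →
                ∀ u → mapTuples ā (g ∘ᴱ f) u ≡ mapTuples ā g (mapTuples ā f u)
  mapTuples-∘ g f u = value-injective (map-∘ _ _ (value u))

  Monochromatic : ∀ {k} → Colouring C ā k → Embedding B C → Set ℓ
  Monochromatic χ h = Constant (χ ∘ mapTuples ā h)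

≡⇒⇔ : ∀ {a} {X Y : Set a} → X ≡ Y → X ⇔ Y
≡⇒⇔ refl = mk⇔ id id

restrict : (h : Embedding B C) {P : Pred (Carrier C) _} →
           (∀ x → P (Embedding.to h x)) → Embedding B (C ↾ P)
restrict {C = C} h p = record
  { to        = λ x → to x , [ p x ]
  ; injective = injective ∘ cong value
  ; relations = λ R v → ≡⇒⇔ (cong (Structure.interp C R) (map-∘ value _ v)) ⇔-∘ relations R v
  }
  where open Embedding h

inverse : A ≅ B → Embedding B A
inverse {A = A} {B = B} g = record
  { to        = λ y → proj₁ (surjective y)
  ; injective = λ {x} {y} e → trans (sym (section x)) (trans (cong to e) (section y))
  ; relations = λ R v → ⇔-sym (relations R _) ⇔-∘ ≡⇒⇔ (cong (Structure.interp B R)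
      (sym (trans (sym (map-∘ to _ v)) (trans (map-cong section v) (map-id v)))))
  }
  where
  open _≅_ g
  section : ∀ y → to (proj₁ (surjective y)) ≡ y
  section y = proj₂ (surjective y) refl

inverse-section : (g : A ≅ B) → ∀ y → _≅_.to g (Embedding.to (inverse g) y) ≡ y
inverse-section g y = proj₂ (_≅_.surjective g y) refl

copyEmbedding : (B′ : CopyIn C B) → Embedding B C
copyEmbedding {C = C} (P , g) = inclusion C P ∘ᴱ _≅_.embedding g

copyEmbedding-monochromatic :
  ∀ (ā : Enumerated L ℓ) {C B : Structure L ℓ} {k} (χ : Colouring C ā k) (B′ : CopyIn C B) →
  Constant (χ ∘ mapTuples ā (inclusion C (proj₁ B′))) → Monochromatic ā χ (copyEmbedding B′)
copyEmbedding-monochromatic ā {C} χ (P , g) const u v =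
  trans (cong χ (mapTuples-∘ ā (inclusion C P) (_≅_.embedding g) u))
    (trans (const (mapTuples ā (_≅_.embedding g) u) (mapTuples ā (_≅_.embedding g) v))
      (cong χ (sym (mapTuples-∘ ā (inclusion C P) (_≅_.embedding g) v))))

-- Invariance of formulae and of external definability under isomorphism.

≅-elementary : (σ : A ≅ B) → ∀ {n} (φ : Formula _ n) (v : Vec (Carrier A) n) →
               (A ⊨ φ [ v ]) ⇔ (B ⊨ φ [ map (_≅_.to σ) v ])
≅-elementary σ (eq i j) v = mk⇔
  (λ e → trans (lookup-map i to v) (trans (cong to e) (sym (lookup-map j to v))))
  (λ e → injective (trans (sym (lookup-map i to v)) (trans e (lookup-map j to v))))
  where open _≅_ σ
≅-elementary {B = B} σ (rel R is) v =
  ≡⇒⇔ (cong (Structure.interp B R)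
    (trans (sym (map-∘ to (lookup v) is)) (map-cong (λ i → sym (lookup-map i to v)) is)))
  ⇔-∘ relations R (map (lookup v) is)
  where open _≅_ σ
≅-elementary σ (neg φ) v = mk⇔
  (λ n s → n (Equivalence.from (≅-elementary σ φ v) s))
  (λ n s → n (Equivalence.to (≅-elementary σ φ v) s))
≅-elementary σ (and φ ψ) v = mk⇔
  (λ (s , t) → Equivalence.to (≅-elementary σ φ v) s , Equivalence.to (≅-elementary σ ψ v) t)
  (λ (s , t) → Equivalence.from (≅-elementary σ φ v) s , Equivalence.from (≅-elementary σ ψ v) t)
≅-elementary {B = B} σ (ex φ) v = mk⇔
  (λ (x , s) → to x , Equivalence.to (≅-elementary σ φ (x ∷ v)) s)
  (λ (y , s) → let x , p = surjective y in
    x , Equivalence.from (≅-elementary σ φ (x ∷ v))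
          (subst (λ z → B ⊨ φ [ z ∷ map to v ]) (sym (p refl)) s))
  where open _≅_ σ

-- The extension, the formulae and the parameters stay the same; only the embedding of `M` is
-- precomposed with `σ`, and it remains elementary because automorphisms preserve every formula.
automorphism-externallyDefinable :
  ∀ {M : Structure L ℓ} {ā k m} {Φ : List (Formula L (m + size ā))} (σ : M ≅ M)
  {χ : Colouring M ā k} → ExternallyDefinable M ā Φ χ →
  ExternallyDefinable M ā Φ (χ ∘ mapTuples ā (_≅_.embedding σ))
automorphism-externallyDefinable {ā = ā} σ (φ , φ∈Φ , N , e , defines) =
  φ , φ∈Φ , N∘σ , e , λ u c →
    ≡⇒⇔ (cong (λ w → extension ⊨ φ c [ e ++ w ]) (sym (map-∘ embed to (value u))))
    ⇔-∘ defines (mapTuples ā embedding u) c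
  where
  open ElementaryExtension N
  open _≅_ σ
  N∘σ : ElementaryExtension _
  N∘σ = record
    { extension  = extension
    ; embed      = embed ∘ to
    ; elementary = λ ψ v →
        ≡⇒⇔ (cong (λ w → extension ⊨ ψ [ w ]) (sym (map-∘ embed to v)))
        ⇔-∘ elementary ψ (map to v) ⇔-∘ ≅-elementary σ ψ v
    }

lookup-injective : ∀ {a} {X : Set a} {xs : List X} → Unique xs →
                   ∀ i j → List.lookup xs i ≡ List.lookup xs j → i ≡ j
lookup-injective (x≢ ∷ u) zero    zero    e = refl
lookup-injective (x≢ ∷ u) zero    (suc j) e = contradiction e (All.lookup x≢ (∈-lookup j))
lookup-injective (x≢ ∷ u) (suc i) zero    e = contradiction (sym e) (All.lookup x≢ (∈-lookup i))
lookup-injective (x≢ ∷ u) (suc i) (suc j) e = cong suc (lookup-injective u i j e)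

-- Classical logic, with subsets as Boolean predicates.

module Classical (em : ∀ {a} → ExcludedMiddle a) (ext : ∀ {a b} → Extensionality a b) where

  private
    variable
      a b : Level

  dne : {A : Set a} → ¬ ¬ A → A
  dne = decidable-stable em

  opaque
    -- Truth values in `Bool` keep subsets of `X`, and families of subsets, at the level of `X`, so
    -- that arbitrary unions stay in the same type.
    ⟦_⟧ : Set a → Bool
    ⟦ A ⟧ = isYes (em {P = A})

    ⟦⟧⁺ : {A : Set a} → A → T ⟦ A ⟧
    ⟦⟧⁺ = fromWitness

    ⟦⟧⁻ : {A : Set a} → T ⟦ A ⟧ → A
    ⟦⟧⁻ = toWitness

  Bool-ext : {A : Set a} {f g : A → Bool} →
             (∀ x → T (f x) → T (g x)) → (∀ x → T (g x) → T (f x)) → f ≡ g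
  Bool-ext to from = ext λ x → ⇔→≡
    (mk⇔ (Equivalence.to T-≡ ∘ to x ∘ Equivalence.from T-≡)
         (Equivalence.to T-≡ ∘ from x ∘ Equivalence.from T-≡))

  -- Teichmüller–Tukey.  The maximal set is the union of the tower obtained by
  -- adding admissible elements one at a time; as in the Bourbaki–Witt theorem,
  -- the tower is a chain.
  module Tukey {x p} {X : Set x} (P : List X → Set p)
               (P-[] : P []) (P-⊆ : ∀ {xs ys} → xs ⊆ ys → P ys → P xs) where

    Subset : Set x
    Subset = X → Bool

    private
      variable
        R S : Subset

    infix 4 _≤_

    _≤_ : Subset → Subset → Set x
    R ≤ S = ∀ x → T (R x) → T (S x)

    ≤-trans : ∀ {Q} → Q ≤ R → R ≤ S → Q ≤ S
    ≤-trans p q x = q x ∘ p x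

    Within : Subset → Pred (List X) x
    Within S = All (λ x → T (S x))

    within-mono : R ≤ S → ∀ {xs} → Within R xs → Within S xs
    within-mono p = All.map (p _)

    Consistent : Subset → Set _
    Consistent S = ∀ xs → Within S xs → P xs

    Admissible : Subset → X → Set _
    Admissible S x = ∀ xs → Within S xs → P (x ∷ xs)

    Extendable : Subset → Set _
    Extendable S = ∃ λ x → ¬ T (S x) × Admissible S x

    insert : X → Subset → Subset
    insert x S y = S y ∨ ⟦ x ≡ y ⟧

    extend : ∀ S → Dec (Extendable S) → Subset
    extend S (yes (x , _)) = insert x S
    extend S (no _)        = S

    next : Subset → Subset
    next S = extend S em

    ≤-insert : ∀ x S → S ≤ insert x S
    ≤-insert x S y = Equivalence.from T-∨ ∘ inj₁

    ∈-insert : ∀ x S → T (insert x S x)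
    ∈-insert x S = Equivalence.from (T-∨ {S x}) (inj₂ (⟦⟧⁺ refl))

    ≤-next : ∀ S → S ≤ next S
    ≤-next S with em {P = Extendable S}
    ... | yes (x , _) = ≤-insert x S
    ... | no _        = λ _ → id

    ⋃ : (Subset → Bool) → Subset
    ⋃ C x = ⟦ (∃ λ S → T (C S) × T (S x)) ⟧

    ≤-⋃ : ∀ C → T (C S) → S ≤ ⋃ C
    ≤-⋃ C cS x Sx = ⟦⟧⁺ (_ , cS , Sx)

    ⋃-≤ : ∀ C → (∀ S → T (C S) → S ≤ R) → ⋃ C ≤ R
    ⋃-≤ C p x m with ⟦⟧⁻ m
    ... | S , cS , Sx = p S cS x Sx

    -- Mutually included subsets are equal by extensionality, so the same new element is chosen for
    -- both.
    next-cong : R ≤ S → S ≤ R → next R ≤ next S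
    next-cong p q = subst (λ Q → next _ ≤ next Q) (Bool-ext p q) λ _ → id

    -- The empty set needs no constructor: it is the union of the empty family.
    data Tower : Subset → Set x where
      step : Tower S → Tower (next S)
      sup  : ∀ C → (∀ S → T (C S) → Tower S) → Tower (⋃ C)

    -- The extreme points of the Bourbaki-Witt argument: no tower member strictly below `S` jumps
    -- past `S` in one step.
    Extreme : Subset → Set x
    Extreme S = ∀ {R} → Tower R → R ≤ S → ¬ S ≤ R → next R ≤ S

    -- Induction on the tower: a member below `S` either equals `S`, or its successor is still below
    -- `S` by extremality.
    extreme-comparable : Extreme S → Tower R → R ≤ S ⊎ next S ≤ R
    extreme-comparable e (step {R} t) with extreme-comparable e t
    ... | inj₂ q = inj₂ (≤-trans q (≤-next R))
    extreme-comparable {S} e (step {R} t) | inj₁ R≤S with em {P = S ≤ R}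
    ... | yes S≤R = inj₂ (next-cong S≤R R≤S)
    ... | no  S≰R = inj₁ (e t R≤S S≰R)
    extreme-comparable {S} e (sup C c) with em {P = ∃ λ R → T (C R) × next S ≤ R}
    ... | yes (R , cR , q) = inj₂ (≤-trans q (≤-⋃ C cR))
    ... | no none = inj₁ (⋃-≤ C λ R cR →
          Sum.[ id , (λ q → ⊥-elim (none (R , cR , q))) ]′ (extreme-comparable e (c R cR)))

    -- A member strictly below a successor lies below its predecessor by comparability. A member `R`
    -- that does not contain a union fails to contain the successor of some `S` in the family, and
    -- so lies below that `S`.
    tower-extreme : Tower S → Extreme S
    tower-extreme (step {S} s) {R} t _ ≰R with extreme-comparable (tower-extreme s) t
    ... | inj₂ q = ⊥-elim (≰R q)
    ... | inj₁ R≤S with em {P = S ≤ R}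
    ...   | yes S≤R = next-cong R≤S S≤R
    ...   | no  S≰R = ≤-trans (tower-extreme s t R≤S S≰R) (≤-next S)
    tower-extreme (sup C c) {R} t _ ≰R with em {P = ∃ λ S → Σ (T (C S)) λ _ → ¬ next S ≤ R}
    ... | no none = ⊥-elim (≰R (⋃-≤ C λ S cS →
          ≤-trans (≤-next S) (dne λ n → none (S , cS , n))))
    ... | yes (S , cS , n) with extreme-comparable (tower-extreme (c S cS)) t
    ...   | inj₂ q = ⊥-elim (n q)
    ...   | inj₁ R≤S with em {P = S ≤ R}
    ...     | no S≰R = ≤-trans (tower-extreme (c S cS) t R≤S S≰R) (≤-⋃ C cS)
    -- Here `R` and `S` coincide. If `next R` were not inside the union, every member of `C` would
    -- lie below `S`, and the union would lie below `R`.
    ...     | yes S≤R = dne λ nR≰ → ≰R (⋃-≤ C λ S′ cS′ →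
              Sum.[ (λ S′≤S → ≤-trans S′≤S S≤R)
                  , (λ q → ⊥-elim (nR≰ (≤-trans (next-cong R≤S S≤R) (≤-trans q (≤-⋃ C cS′))))) ]′
              (extreme-comparable (tower-extreme (c S cS)) (c S′ cS′)))

    tower-linear : Tower R → Tower S → S ≤ R ⊎ R ≤ S
    tower-linear {R} r s =
      Sum.map₂ (≤-trans (≤-next R)) (extreme-comparable (tower-extreme r) s)

    within-insert : ∀ x S {xs} → Within (insert x S) xs → ∃ λ ys → Within S ys × xs ⊆ x ∷ ys
    within-insert x S []       = [] , [] , λ ()
    within-insert x S (w ∷ ws) with within-insert x S ws | Equivalence.to (T-∨ {S _}) w
    ... | ys , v , q | inj₁ Sy = _ ∷ ys , Sy ∷ v ,
          ∈-∷⁺ʳ (there (here refl)) (⊆-trans q (∷⁺ʳ x (xs⊆x∷xs ys _)))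
    ... | ys , v , q | inj₂ e with ⟦⟧⁻ e
    ...   | refl = ys , v , ∈-∷⁺ʳ (here refl) q

    -- Finitely many members of a chain have a largest one. The list is nonempty because `C` may
    -- have no members.
    within-chain : ∀ C → (∀ S → T (C S) → Tower S) → ∀ {x xs} → Within (⋃ C) (x ∷ xs) →
                   ∃ λ S → T (C S) × Within S (x ∷ xs)
    within-chain C c {xs = []} (w ∷ []) with ⟦⟧⁻ w
    ... | S , cS , Sx = S , cS , Sx ∷ []
    within-chain C c {xs = _ ∷ _} (w ∷ ws) with ⟦⟧⁻ w | within-chain C c ws
    ... | S , cS , Sx | R , cR , v with tower-linear (c R cR) (c S cS)
    ...   | inj₁ S≤R = R , cR , S≤R _ Sx ∷ v
    ...   | inj₂ R≤S = S , cS , Sx ∷ within-mono R≤S v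

    insert-consistent : ∀ x S → Admissible S x → Consistent (insert x S)
    insert-consistent x S adm xs w with within-insert x S w
    ... | ys , v , q = P-⊆ q (adm ys v)

    tower-consistent : Tower S → Consistent S
    tower-consistent (step {S} s) with em {P = Extendable S}
    ... | yes (x , _ , adm) = insert-consistent x S adm
    ... | no _              = tower-consistent s
    tower-consistent (sup C c) []       w = P-[]
    tower-consistent (sup C c) (x ∷ xs) w with within-chain C c w
    ... | S , cS , v = tower-consistent (c S cS) (x ∷ xs) v

    maximal : Subset
    maximal = ⋃ λ S → ⟦ Tower S ⟧

    maximal-tower : Tower maximal
    maximal-tower = sup _ λ _ → ⟦⟧⁻

    maximal-consistent : Consistent maximal
    maximal-consistent = tower-consistent maximal-tower

    maximal-admits : ∀ x → Admissible maximal x → T (maximal x)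
    maximal-admits x adm = dne λ x∉ → not-extendable (x , x∉ , adm)
      where
      -- The union of the whole tower belongs to the tower, hence so does its successor, which is
      -- therefore one of the united sets.
      top : next maximal ≤ maximal
      top = ≤-⋃ _ (⟦⟧⁺ (step maximal-tower))

      not-extendable : ¬ Extendable maximal
      not-extendable e with em {P = Extendable maximal} | top
      ... | yes (y , y∉ , _) | t = y∉ (t y (∈-insert y maximal))
      ... | no n             | _ = n e

  -- Ultrafilters containing the cones of a directed relation.

  module Ultrafilter {ℓ} {I : Set ℓ} (origin : I) (_≤_ : I → I → Set ℓ)
                     (≤-trans : ∀ {i j k} → i ≤ j → j ≤ k → i ≤ k)
                     (directed : ∀ i j → ∃ λ k → i ≤ k × j ≤ k) where

    -- The finite intersection property relative to cones: the intersection of the list meets every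
    -- cone. A maximal family with this property is an ultrafilter containing the cones.
    Cofinal : List (I → Bool) → Set ℓ
    Cofinal As = ∀ i → ∃ λ j → i ≤ j × All (λ A → T (A j)) As

    private
      cofinal-[] : Cofinal []
      cofinal-[] i with directed i i
      ... | k , i≤k , _ = k , i≤k , []

      cofinal-⊆ : ∀ {As Bs} → As ⊆ Bs → Cofinal Bs → Cofinal As
      cofinal-⊆ As⊆Bs c i with c i
      ... | j , i≤j , w = j , i≤j , All-resp-⊇ As⊆Bs w

      module U = Tukey Cofinal cofinal-[] cofinal-⊆

    -- Membership in the ultrafilter. The level is `ℓ` whatever the level of `A`, so largeness can
    -- interpret relations in a structure at level `ℓ`.
    record Large {a} (A : Pred I a) : Set ℓ where
      constructor large
      no-eta-equality
      pattern
      field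
        member : T (U.maximal λ i → ⟦ A i ⟧)

    private
      variable
        P : Pred I a
        Q : Pred I b

    -- By maximality it suffices that adding `Q` preserves cofinality. Above a common bound of `i`
    -- and `i′`, the sets already present have a common point, and that point satisfies `Q`.
    large-superset : ∀ As → U.Within U.maximal As → ∀ i →
                     (∀ {j} → i ≤ j → All (λ P → T (P j)) As → Q j) → Large Q
    large-superset As ws i p = large (U.maximal-admits _ λ Bs vs i′ →
      let k , i≤k , i′≤k = directed i i′
          j , k≤j , w    = U.maximal-consistent (As List.++ Bs) (All.++⁺ ws vs) k
      in j , ≤-trans i′≤k k≤j , ⟦⟧⁺ (p (≤-trans i≤k k≤j) (All.++⁻ˡ As w)) ∷ All.++⁻ʳ As w)

    large-cone : ∀ i → Large (i ≤_)
    large-cone i = large-superset [] [] i λ i≤j _ → i≤j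

    large-mono : (∀ {i} → P i → Q i) → Large P → Large Q
    large-mono {P = P} p (large m) = large-superset (_ ∷ []) (m ∷ []) origin
      λ { _ (w ∷ []) → p (⟦⟧⁻ w) }

    large-∩ : Large P → Large Q → Large (P ∩ Q)
    large-∩ (large m) (large n) = large-superset (_ ∷ _ ∷ []) (m ∷ n ∷ []) origin
      λ { _ (v ∷ w ∷ []) → ⟦⟧⁻ v , ⟦⟧⁻ w }

    large-all : (∀ i → P i) → Large P
    large-all p = large-mono (λ _ → p _) (large-cone origin)

    large-∃ : Large P → ∃ P
    large-∃ (large m) with U.maximal-consistent (_ ∷ []) (m ∷ []) origin
    ... | j , _ , w ∷ [] = j , ⟦⟧⁻ w

    -- If `P` cannot be added, some finitely many members of the ultrafilter have no common point
    -- with `P` in some cone; within that cone their intersection lies in the complement.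
    large-∁ : ¬ Large P → Large (∁ P)
    large-∁ {P = P} P-small = dne λ ∁P-small → P-small (large (U.maximal-admits _ λ Bs vs i →
      dne λ none → ∁P-small (large-superset Bs vs i λ {j} i≤j w Pj →
        none (j , i≤j , ⟦⟧⁺ Pj ∷ w))))

    large-disjoint : Large P → ¬ Large (∁ P)
    large-disjoint P-large ∁P-large with large-∃ (large-∩ P-large ∁P-large)
    ... | _ , Pi , ¬Pi = ¬Pi Pi

    large-⇔ : Large (λ i → P i ⇔ Q i) → Large P ⇔ Large Q
    large-⇔ e = mk⇔
      (large-mono (λ (f , Pi) → Equivalence.to f Pi) ∘ large-∩ e)
      (large-mono (λ (f , Qi) → Equivalence.from f Qi) ∘ large-∩ e)

    large-∀Fin : ∀ {n} {P : Fin n → Pred I a} → (∀ x → Large (P x)) → Large λ i → ∀ x → P x i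
    large-∀Fin {n = zero}  p = large-all λ _ ()
    large-∀Fin {n = suc n} p =
      large-mono (λ { (z , s) zero → z ; (z , s) (suc x) → s x })
        (large-∩ (p zero) (large-∀Fin (p ∘ suc)))

    large-∀Vec : ∀ {X : Set b} {n} (f : Fin n → X) → (∀ x → ∃ λ j → f j ≡ x) →
                 ∀ {m} {P : Vec X m → Pred I a} → (∀ v → Large (P v)) → Large λ i → ∀ v → P v i
    large-∀Vec f f-onto {zero} {P} p = large-mono (λ { q [] → q }) (p [])
    large-∀Vec f f-onto {suc m} {P} p =
      large-mono (λ { {i} q (x ∷ v) → let j , e = f-onto x in subst (λ y → P (y ∷ v) i) e (q j v) })
        (large-∀Fin λ j → large-∀Vec f f-onto λ v → p (f j ∷ v))

    -- An element of a refinement is determined by its `value`, and there are finitely many vectors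
    -- over a finite set. This makes pointwise convergence uniform on the tuples of a finite
    -- structure.
    large-∀Refinement :
      ∀ {X : Set b} {n} (f : Fin n → X) → (∀ x → ∃ λ j → f j ≡ x) →
      ∀ {m p} {R : Pred (Vec X m) p} {P : Refinement (Vec X m) R → Pred I a} →
      (∀ u → Large (P u)) → Large λ i → ∀ u → P u i
    large-∀Refinement f f-onto {m} {R = R} {P} p =
      large-mono (λ q u → q (value u) u refl) (large-∀Vec f f-onto fibre)
      where
      fibre : ∀ v → Large λ i → ∀ u → value u ≡ v → P u i
      fibre v with em {P = ∃ λ (u : Refinement (Vec _ m) R) → value u ≡ v}
      ... | no none        = large-all λ _ u e → contradiction (u , e) none
      ... | yes (u , refl) =
        large-mono (λ {i} Pi u′ e → subst (λ w → P w i) (sym (value-injective e)) Pi) (p u)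

    -- Otherwise the complements of the finitely many fibres would all be large, and `f` would have
    -- no value at a common point.
    lim : ∀ {n} (f : I → Fin n) → ∃ λ x → Large λ i → f i ≡ x
    lim f = dne λ none → let i , p = large-∃ (large-∀Fin λ x → large-∁ λ l → none (x , l)) in p (f i) refl

    -- Ultraproducts and Łoś's theorem.

    module Ultraproduct {L : Language} (N : I → Structure L ℓ)
                        (transfer : ∀ {i j} → Carrier (N i) → Carrier (N j)) where

      Sequence : Set ℓ
      Sequence = ∀ i → Carrier (N i)

      infix 4 _~_

      _~_ : Sequence → Sequence → Set ℓ
      x ~ y = Large λ i → x i ≡ y i

      -- The proof of inhabitation is irrelevant, so the chosen element depends on the class alone.
      pick : (c : Sequence → Bool) → .(∃ (T ∘ c)) → ∃ (T ∘ c)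
      pick c p = recompute em p

      pick-cong : ∀ {c d} .{p q} → c ≡ d → proj₁ (pick c p) ≡ proj₁ (pick d q)
      pick-cong refl = refl

      class : Sequence → Sequence → Bool
      class x y = ⟦ x ~ y ⟧

      class-inhabited : ∀ x → ∃ (T ∘ class x)
      class-inhabited x = x , ⟦⟧⁺ (large-all λ _ → refl)

      -- Ultraproduct elements must be equal as soon as they agree on a large set,
      -- so each class is represented by one chosen sequence.
      rep : Sequence → Sequence
      rep x = proj₁ (pick (class x) (class-inhabited x))

      rep-~ : ∀ x → x ~ rep x
      rep-~ x = ⟦⟧⁻ (proj₂ (pick (class x) (class-inhabited x)))

      rep-cong : ∀ {x y} → x ~ y → rep x ≡ rep y
      rep-cong x~y = pick-cong (Bool-ext
        (λ z p → ⟦⟧⁺ (large-mono (λ (e , f) → trans (sym e) f) (large-∩ x~y (⟦⟧⁻ p))))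
        (λ z p → ⟦⟧⁺ (large-mono (λ (e , f) → trans e f) (large-∩ x~y (⟦⟧⁻ p)))))

      Element : Set ℓ
      Element = Refinement Sequence λ x → rep x ≡ x

      at : ∀ i → Element → Carrier (N i)
      at i z = value z i

      ⟨_⟩ : Sequence → Element
      ⟨ x ⟩ = rep x , [ sym (rep-cong (rep-~ x)) ]

      at-⟨⟩ : ∀ x → Large λ i → at i ⟨ x ⟩ ≡ x i
      at-⟨⟩ x = large-mono sym (rep-~ x)

      element-ext : ∀ {z w} → Large (λ i → at i z ≡ at i w) → z ≡ w
      element-ext {x , [ p ]} {y , [ q ]} x~y =
        value-injective (trans (sym (recompute em p)) (trans (rep-cong x~y) (recompute em q)))

      ultraproduct : Structure L ℓ
      ultraproduct = record
        { Carrier = Element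
        ; interp  = λ R v → Large λ i → Structure.interp (N i) R (map (at i) v)
        }

      -- Induction on the formula: conjunction uses the filter laws, negation the ultrafilter
      -- property, and the quantifier a sequence of chosen witnesses.
      łoś : ∀ {n} (φ : Formula L n) (v : Vec Element n) →
            (ultraproduct ⊨ φ [ v ]) ⇔ Large (λ i → N i ⊨ φ [ map (at i) v ])
      łoś (eq j k) v = mk⇔
        (λ e → large-all λ i → trans (lookup-map j (at i) v)
          (trans (cong (at i) e) (sym (lookup-map k (at i) v))))
        (λ l → element-ext (large-mono (λ {i} e →
          trans (sym (lookup-map j (at i) v)) (trans e (lookup-map k (at i) v))) l))
      łoś (rel R js) v = large-⇔ (large-all λ i → ≡⇒⇔ (cong (Structure.interp (N i) R)
        (trans (sym (map-∘ (at i) (lookup v) js)) (map-cong (λ j → sym (lookup-map j (at i) v)) js))))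
      łoś (neg φ) v = mk⇔
        (λ n → large-∁ λ l → n (Equivalence.from (łoś φ v) l))
        (λ l s → large-disjoint (Equivalence.to (łoś φ v) s) l)
      łoś (and φ ψ) v = mk⇔
        (λ (s , t) → large-∩ (Equivalence.to (łoś φ v) s) (Equivalence.to (łoś ψ v) t))
        (λ l → Equivalence.from (łoś φ v) (large-mono proj₁ l)
             , Equivalence.from (łoś ψ v) (large-mono proj₂ l))
      łoś (ex φ) v = mk⇔
        (λ (z , s) → large-mono (λ t → _ , t) (Equivalence.to (łoś φ (z ∷ v)) s))
        λ l →
          -- A sequence needs a value at every index; where there is no witness, an element is
          -- transferred from an index that has one.
          let default : ∀ i → Carrier (N i)
              default i = transfer (proj₁ (proj₂ (large-∃ l)))

              Witness : I → Set ℓ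
              Witness i = ∃ λ x → N i ⊨ φ [ x ∷ map (at i) v ]

              choose : ∀ i → Dec (Witness i) → Carrier (N i)
              choose i = λ { (yes w) → proj₁ w ; (no _) → default i }

              correct : ∀ {i} (d : Dec (Witness i)) → Witness i → N i ⊨ φ [ choose i d ∷ map (at i) v ]
              correct = λ { (yes w) _ → proj₂ w ; (no n) w → contradiction w n }

              z = λ i → choose i em
          in ⟨ z ⟩ , Equivalence.from (łoś φ (⟨ z ⟩ ∷ v)) (large-mono
               (λ {i} (w , e) → subst (λ x → N i ⊨ φ [ x ∷ map (at i) v ]) (sym e) (correct em w))
               (large-∩ l (at-⟨⟩ z)))

      at-map-⟨⟩ : ∀ {n} (v : Vec Sequence n) →
                  Large λ i → map (at i) (map ⟨_⟩ v) ≡ map (λ x → x i) v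
      at-map-⟨⟩ []      = large-all λ _ → refl
      at-map-⟨⟩ (x ∷ v) = large-mono (λ (e , f) → cong₂ _∷_ e f) (large-∩ (at-⟨⟩ x) (at-map-⟨⟩ v))

    -- Limits of externally definable colourings.

    large-const : {A : Set a} → A ⇔ Large (λ _ → A)
    large-const = mk⇔ (λ x → large-all λ _ → x) (λ l → proj₂ (large-∃ l))

    lim-externallyDefinable :
      ∀ {L : Language} {M : Structure L ℓ} {ā k m} {Φ : List (Formula L (m + size ā))}
      (χ : I → Colouring M ā k) → (∀ i → ExternallyDefinable M ā Φ (χ i)) →
      (χ̂ : Colouring M ā k) → (∀ u → Large λ i → χ i u ≡ χ̂ u) →
      ExternallyDefinable M ā Φ χ̂
    lim-externallyDefinable {L} {M} {ā} {k} {m} {Φ} χ def χ̂ χ→χ̂ =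
      φ̂ , (λ c → ∈-lookup (position c)) , N̂ , ê , defines
      where
      φ : I → Fin k → Formula L (m + size ā)
      φ i = proj₁ (def i)

      φ∈Φ : ∀ i c → φ i c ∈ Φ
      φ∈Φ i = proj₁ (proj₂ (def i))

      module N (i : I) = ElementaryExtension (proj₁ (proj₂ (proj₂ (def i))))

      e : ∀ i → Vec (Carrier (N.extension i)) m
      e i = proj₁ (proj₂ (proj₂ (proj₂ (def i))))

      -- The limit is taken over positions in `Φ`, of which there are finitely many.
      position : Fin k → Fin (List.length Φ)
      position c = proj₁ (lim λ i → index (φ∈Φ i c))

      φ̂ : Fin k → Formula L (m + size ā)
      φ̂ c = List.lookup Φ (position c)

      φ→φ̂ : ∀ c → Large λ i → φ i c ≡ φ̂ c
      φ→φ̂ c = large-mono (λ {i} p → trans (lookup-index (φ∈Φ i c)) (cong (List.lookup Φ) p))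
        (proj₂ (lim λ i → index (φ∈Φ i c)))

      -- Nonemptiness is the sentence "some x equals itself", so it descends from one factor to `M`,
      -- and an element of `M` embeds into every other factor.
      transfer : ∀ {i j} → Carrier (N.extension i) → Carrier (N.extension j)
      transfer {i} {j} x = N.embed j
        (proj₁ (Equivalence.from (N.elementary i (ex (eq zero zero)) []) (x , refl)))

      open Ultraproduct N.extension transfer

      constant : Carrier M → Sequence
      constant x i = N.embed i x

      at-map-constant : ∀ {n} (v : Vec (Carrier M) n) →
                        Large λ i → map (at i) (map (⟨_⟩ ∘ constant) v) ≡ map (N.embed i) v
      at-map-constant v = large-mono
        (λ {i} p → trans (cong (map (at i)) (map-∘ ⟨_⟩ constant v))
          (trans p (sym (map-∘ (λ x → x i) constant v))))
        (at-map-⟨⟩ (map constant v))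

      N̂ : ElementaryExtension M
      N̂ = record
        { extension  = ultraproduct
        ; embed      = ⟨_⟩ ∘ constant
        ; elementary = λ ψ v →
            ⇔-sym (łoś ψ (map (⟨_⟩ ∘ constant) v))
            ⇔-∘ large-⇔ (large-mono
                  (λ {i} p → subst (λ w → (M ⊨ ψ [ v ]) ⇔ (N.extension i ⊨ ψ [ w ])) (sym p)
                    (N.elementary i ψ v))
                  (at-map-constant v))
            ⇔-∘ large-const
        }

      ẽ : Vec Sequence m
      ẽ = tabulate λ j i → lookup (e i) j

      ê : Vec Element m
      ê = map ⟨_⟩ ẽ

      at-ê : Large λ i → map (at i) ê ≡ e i
      at-ê = large-mono
        (λ {i} p → trans p (trans (sym (tabulate-∘ (λ x → x i) λ j i → lookup (e i) j)) (tabulate∘lookup (e i))))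
        (at-map-⟨⟩ ẽ)

      assignment : ∀ {n} (v : Vec (Carrier M) n) →
                   Large λ i → map (at i) (ê ++ map (⟨_⟩ ∘ constant) v) ≡ e i ++ map (N.embed i) v
      assignment v = large-mono
        (λ {i} (p , q) → trans (map-++ (at i) ê _) (cong₂ _++_ p q))
        (large-∩ at-ê (at-map-constant v))

      defines : ∀ u c → χ̂ u ≡ c ⇔ (ultraproduct ⊨ φ̂ c [ ê ++ map (⟨_⟩ ∘ constant) (value u) ])
      defines u c =
        ⇔-sym (łoś (φ̂ c) (ê ++ map (⟨_⟩ ∘ constant) (value u)))
        -- On one large set the colour, the formula and the assignment all agree with their limits,
        -- so the definition in each such factor can be used.
        ⇔-∘ large-⇔ (large-mono
              (λ {i} (p , q , r) →
                ≡⇒⇔ (cong₂ (λ ψ w → N.extension i ⊨ ψ [ w ]) q (sym r))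
                ⇔-∘ proj₂ (proj₂ (proj₂ (proj₂ (def i)))) u c
                ⇔-∘ ≡⇒⇔ (cong (_≡ c) (sym p)))
              (large-∩ (χ→χ̂ u) (large-∩ (φ→φ̂ c) (assignment (value u)))))
        ⇔-∘ large-const

  -- Finite substructures and images of embeddings.

  list-finite : (M : Structure L ℓ) (xs : List (Carrier M)) → Finite (M ↾ (_∈ xs))
  list-finite M xs = List.length ys , mk⤖ {to = to} (injective , surjective)
    where
    _≟_ : (x y : Carrier M) → Dec (x ≡ y)
    _ ≟ _ = em

    ys : List (Carrier M)
    ys = List.deduplicate _≟_ xs

    to : Fin (List.length ys) → Carrier (M ↾ (_∈ xs))
    to i = List.lookup ys i , [ ∈-deduplicate⁻ _≟_ xs (∈-lookup i) ]

    injective : ∀ {i j} → to i ≡ to j → i ≡ j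
    injective e = lookup-injective (Unique.deduplicate-! _≟_ xs) _ _ (cong value e)

    surjective : ∀ y → ∃ λ i → ∀ {j} → j ≡ i → to j ≡ y
    surjective (x , [ x∈xs ]) = index x∈ys , λ { refl → value-injective (sym (lookup-index x∈ys)) }
      where
      x∈ys : x ∈ ys
      x∈ys = ∈-deduplicate⁺ _≟_ (recompute em x∈xs)

  image : Embedding B C → Pred (Carrier C) _
  image h y = ∃ λ x → Embedding.to h x ≡ y

  image-≅ : (h : Embedding B C) → B ≅ (C ↾ image h)
  image-≅ h = record
    { embedding  = restrict h λ x → x , refl
    ; surjective = λ (y , [ p ]) → let x , e = recompute em p in
        x , λ { refl → value-injective e }
    }

  imageCopy : Embedding B C → CopyIn C B
  imageCopy h = image h , image-≅ h

  -- Every tuple of the image is the `h`-image of a tuple of `B`, obtained through the inverse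
  -- isomorphism.
  imageCopy-constant :
    ∀ (ā : Enumerated L ℓ) {C B : Structure L ℓ} {k} (χ : Colouring C ā k) (h : Embedding B C) →
    Monochromatic ā χ h → Constant (χ ∘ mapTuples ā (inclusion C (image h)))
  imageCopy-constant ā {C} χ h mono u v =
    trans (pull u) (trans (mono (mapTuples ā g⁻¹ u) (mapTuples ā g⁻¹ v)) (sym (pull v)))
    where
    g⁻¹ : Embedding (C ↾ image h) _
    g⁻¹ = inverse (image-≅ h)

    pull : ∀ u → χ (mapTuples ā (inclusion C (image h)) u) ≡ χ (mapTuples ā h (mapTuples ā g⁻¹ u))
    pull u = cong χ (trans
      (mapTuples-cong ā (inclusion C (image h)) (h ∘ᴱ g⁻¹)
        (λ y → sym (cong value (inverse-section (image-≅ h) y))) u)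
      (mapTuples-∘ ā h g⁻¹ u))

  -- The two directions of the equivalence.

  ageArrow⇒wholeArrow :
    ∀ {M : Structure L ℓ} {ā B k m} {Φ : List (Formula L (m + size ā))} {C} →
    InAge M C → AgeArrow M ā Φ C B k → WholeArrow M ā Φ B k
  ageArrow⇒wholeArrow {M = M} {ā} (_ , c) arrow χ def =
    imageCopy h , imageCopy-constant ā χ h λ u v →
      trans (cong χ (mapTuples-∘ ā ι j u)) (trans (mono u v) (cong χ (sym (mapTuples-∘ ā ι j v))))
    where
    ι = inclusion M (image c)
    copy = arrow (imageCopy c) χ def
    j = copyEmbedding (proj₁ copy)
    h = ι ∘ᴱ j
    mono = copyEmbedding-monochromatic ā (χ ∘ mapTuples ā ι) (proj₁ copy) (proj₂ copy)

  -- Copies of `B` appear as embeddings into `M` with values in `xs`, which avoids substructures of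
  -- substructures.
  BadColouring : (M : Structure L ℓ) (ā : Enumerated L ℓ) → ∀ {m} → List (Formula L (m + size ā)) →
                 Structure L ℓ → ℕ → List (Carrier M) → Set _
  BadColouring M ā Φ B k xs = ∃ λ (χ : Colouring M ā k) → ExternallyDefinable M ā Φ χ ×
    ((h : Embedding B M) → (∀ x → Embedding.to h x ∈ xs) → ¬ Monochromatic ā χ h)

  -- A colouring defeating one copy of xs defeats xs itself, after composing it with
  -- an automorphism carrying xs to that copy.
  bad-colouring :
    ∀ {M : Structure L ℓ} → Ultrahomogeneous M →
    ∀ {ā B k m} {Φ : List (Formula L (m + size ā))} xs → ¬ AgeArrow M ā Φ (M ↾ (_∈ xs)) B k →
    BadColouring M ā Φ B k xs
  bad-colouring {M = M} uh {ā} {Φ = Φ} xs fails = dne λ none → fails λ (P , f) χ def → dne λ noCopy →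
    let finite = list-finite M xs
        σ , extends = uh (_∈ xs) P finite
          (proj₁ finite , mk⤖ (_≅_.injective f , _≅_.surjective f) ⤖-∘ proj₂ finite) f
        ι = inclusion M P
    in none (χ ∘ mapTuples ā (_≅_.embedding σ) , automorphism-externallyDefinable {ā = ā} {Φ = Φ} σ {χ} def ,
         λ h h∈xs mono →
           let h↾ = restrict h h∈xs
               j = _≅_.embedding f ∘ᴱ h↾
               moved : ∀ u → mapTuples ā ι (mapTuples ā j u)
                             ≡ mapTuples ā (_≅_.embedding σ) (mapTuples ā h u)
               moved u = trans (sym (mapTuples-∘ ā ι j u))
                 (trans (mapTuples-cong ā (ι ∘ᴱ j) (_≅_.embedding σ ∘ᴱ h)
                          (λ x → sym (extends (Embedding.to h↾ x))) u)
                   (mapTuples-∘ ā (_≅_.embedding σ) h u))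
           in noCopy (imageCopy j , imageCopy-constant ā (χ ∘ mapTuples ā ι) j λ u v →
                trans (cong χ (moved u)) (trans (mono u v) (cong χ (sym (moved v))))))

  wholeArrow-refutes-bad :
    ∀ {M : Structure L ℓ} {ā B k m} {Φ : List (Formula L (m + size ā))} → Finite B →
    WholeArrow M ā Φ B k → ¬ (∀ xs → BadColouring M ā Φ B k xs)
  wholeArrow-refutes-bad {M = M} {ā} {B} {k} {Φ = Φ} (n , enum) whole bad =
    -- A single `xs` is chosen that contains the whole copy of `B` and whose colouring equals the
    -- limit on all tuples of that copy.
    let xs , h⊆xs , agrees = large-∃ (large-∩
          (large-cone (List.tabulate (Embedding.to h ∘ elements)))
          (large-∀Refinement elements elements-onto λ u → χ→χ̂ (mapTuples ā h u)))
        mono = copyEmbedding-monochromatic ā χ̂ (proj₁ copy) (proj₂ copy)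
    in proj₂ (proj₂ (bad xs)) h
         (λ x → let i , e = elements-onto x in
           subst (λ y → Embedding.to h y ∈ xs) e (h⊆xs (∈-tabulate⁺ i)))
         (λ u v → trans (agrees u) (trans (mono u v) (sym (agrees v))))
    where
    χ : List (Carrier M) → Colouring M ā k
    χ xs = proj₁ (bad xs)

    open Ultrafilter {I = List (Carrier M)} [] _⊆_ (λ p q → ⊆-trans p q)
      (λ xs ys → xs List.++ ys , xs⊆xs++ys xs ys , xs⊆ys++xs ys xs)

    χ̂ : Colouring M ā k
    χ̂ u = proj₁ (lim λ xs → χ xs u)

    χ→χ̂ : ∀ u → Large λ xs → χ xs u ≡ χ̂ u
    χ→χ̂ u = proj₂ (lim λ xs → χ xs u)

    copy : Σ (CopyIn M B) λ B′ → Constant (χ̂ ∘ mapTuples ā (inclusion M (proj₁ B′)))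
    copy = whole χ̂ (lim-externallyDefinable {ā = ā} {Φ = Φ} χ (λ xs → proj₁ (proj₂ (bad xs))) χ̂ χ→χ̂)

    h : Embedding B M
    h = copyEmbedding (proj₁ copy)

    elements : Fin n → Carrier B
    elements = Bijection.to enum

    elements-onto : ∀ x → ∃ λ i → elements i ≡ x
    elements-onto x = let i , p = Bijection.surjective enum x in i , p refl

  wholeArrow⇒ageArrow :
    ∀ {M : Structure L ℓ} → Ultrahomogeneous M →
    ∀ {ā B k m} {Φ : List (Formula L (m + size ā))} → Finite B →
    WholeArrow M ā Φ B k → ∃ λ C → InAge M C × AgeArrow M ā Φ C B k
  wholeArrow⇒ageArrow {M = M} uh {ā} {Φ = Φ} finite whole = dne λ none →
    wholeArrow-refutes-bad {ā = ā} {Φ = Φ} finite whole λ xs → bad-colouring uh {ā} {Φ = Φ} xs λ arrow →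
      none (M ↾ (_∈ xs) , (list-finite M xs , inclusion M _) , arrow)

proposition3p6 : (∀ {a} → ExcludedMiddle a) →
    (∀ {a b} → Extensionality a b) →
    ∀ {ℓ} (L : Language) (M : Structure L ℓ) → Ultrahomogeneous M →
    (ā : Enumerated L ℓ) → InAge M (Enumerated.structure ā) →
    (B : Structure L ℓ) → InAge M B →
    (k : ℕ) → k ≥ 1 →
    (m : ℕ) (Φ : List (Formula L (m + size ā))) →
    WholeArrow M ā Φ B k ⇔ (∃ λ C → InAge M C × AgeArrow M ā Φ C B k)
proposition3p6 em ext L M uh ā _ B (finite , _) k _ m Φ = mk⇔
  (wholeArrow⇒ageArrow uh {ā} {Φ = Φ} finite)
  (λ (_ , age , arrow) → ageArrow⇒wholeArrow {ā = ā} {Φ = Φ} age arrow)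
  where open Classical em ext
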